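{- Let $d\ge 1$ be an integer. For every $N\in\mathbb{Z}_{\ge 0}$, $$g_d(N)=\sum_{m=1}^{2d-1}\left[\binom{2d}{m}-\binom{d}{m-d}\right]\binom{N-1}{m-1}.$$
   Context: Let $[d]=\{1,\dots,d\}$. A matrix $A\in\mathbb{R}^{d\times d}$ is a $G$-matrix of value $N\in\mathbb{R}_{\ge 0}$ if all its entries are nonnegative and $A_{1,\sigma(1)}+A_{2,\sigma(2)}+\cdots+A_{d,\sigma(d)}=N$ for every permutation $\sigma$ of $[d]$. For $N\in\mathbb{Z}_{\ge 0}$, $g_d(N)$ denotes the number of $d\times d$ $G$-matrices of value $N$ all of whose entries are integers. Binomial coefficients are read as polynomials in the upper argument: $\binom{x}{k}=\frac{x(x-1)\cdots(x-k+1)}{k!}$ for integers $k\ge 0$ (so $\binom{ -1}{k}=(-1)^k$), and $\binom{x}{k}=0$ for integers $k<0$. -}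

module Defs where

open import Data.Fin.Base using (Fin; toℕ)
open import Data.Fin.Permutation using (Permutation′; _⟨$⟩ʳ_)
open import Data.Integer.Base as ℤ using (ℤ; +_; -[1+_]; 0ℤ; 1ℤ)
import Data.Integer.Properties as ℤ
open import Data.Nat.Base as ℕ using (ℕ; zero; suc; _!)
open import Data.Nat.Properties using (_!≢0)
open import Data.Product.Base using (Σ; proj₁)
open import Data.Rational.Base as ℚ using (ℚ; 0ℚ)
import Data.Rational.Properties as ℚ
open import Data.Vec.Functional using (Vector)
open import Data.Vec.Functional.Relation.Binary.Pointwise.Properties using () renaming (setoid to vectorSetoid)
open import Function.Bundles using (Inverse)
open import Level using (0ℓ)
open import Relation.Binary.Bundles using (Setoid)
import Relation.Binary.Construct.On as On
open import Relation.Binary.PropositionalEquality using (_≡_; setoid)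

open import Algebra.Properties.CommutativeMonoid.Sum ℤ.+-0-commutativeMonoid
  using () renaming (sum to sumℤ)
open import Algebra.Properties.CommutativeMonoid.Sum ℚ.+-0-commutativeMonoid
  using () renaming (sum to sumℚ)

IntMatrix : ℕ → Set
IntMatrix d = Vector (Vector ℤ d) d

record IsGMatrix {d : ℕ} (N : ℕ) (A : IntMatrix d) : Set where
  field
    nonNegative : ∀ i j → 0ℤ ℤ.≤ A i j
    value       : ∀ (σ : Permutation′ d) → sumℤ (λ i → A i (σ ⟨$⟩ʳ i)) ≡ + N

-- Equality is entrywise and ignores the proof of IsGMatrix: without function
-- extensionality, propositional equality on this Σ-type would be too fine
-- for counting matrices.
GMatrices : (d N : ℕ) → Setoid 0ℓ 0ℓ
GMatrices d N = On.setoid {B = Σ (IntMatrix d) (IsGMatrix N)}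
  (vectorSetoid (vectorSetoid (setoid ℤ) d) d) proj₁

HasCardinality : Setoid 0ℓ 0ℓ → ℕ → Set
HasCardinality S n = Inverse (setoid (Fin n)) S

-- x (x - 1) ⋯ (x - k + 1)
fallingFactorial : ℤ → ℕ → ℤ
fallingFactorial x zero    = 1ℤ
fallingFactorial x (suc k) = fallingFactorial x k ℤ.* (x ℤ.- + k)

-- The binomial coefficient as a polynomial in its upper argument; in
-- particular binom (-1) k = (-1)ᵏ for k ≥ 0. The division is exact, but is
-- taken in ℚ so that the definition does not depend on that fact.
binom : ℤ → ℤ → ℚ
binom x (+ k)    = fallingFactorial x k ℚ./ (k !)
  where instance _ = k !≢0
binom x -[1+ _ ] = 0ℚ

-- Σ_{m = 1}^{n} f m
sumFrom1To : ℕ → (ℕ → ℚ) → ℚ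
sumFrom1To n f = sumℚ {n} (λ i → f (suc (toℕ i)))

{-# OPTIONS --safe #-}

-- In a G-matrix, two permutations that differ by a transposition show that all 2 × 2 minors
-- satisfy A i j + A k l = A i l + A k j. Hence A i j = r i + c j with natural r and c, unique
-- once min r = 0, and then Σ r + Σ c = N. Sorting the pairs (r , c) by the first zero of r, their
-- number is Σ_{i<d} C(N − i + 2d − 2, 2d − 2) = C(N + 2d − 1, 2d − 1) − C(N + d − 1, 2d − 1).
-- Vandermonde's identity expands both binomial coefficients in the C(N − 1, m − 1), 1 ≤ m ≤ 2d;
-- the two terms with m = 2d cancel.

module Submission where

open import Defs
open import Data.Nat.Base as ℕ using (ℕ; zero; suc; _+_; _*_; _≤_; _∸_; _!; NonZero; s≤s)
open import Data.Integer.Base as ℤ using (ℤ; +_; -[1+_]; 0ℤ; 1ℤ)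
open import Data.Rational.Base as ℚ using (ℚ; 0ℚ; 1ℚ)
open import Data.Product.Base using (∃; Σ-syntax; _×_; _,_)
open import Relation.Binary.PropositionalEquality

open import Data.Empty using (⊥-elim)
open import Data.Fin.Base using (Fin; zero; suc; toℕ; _↑ˡ_; _↑ʳ_; punchIn; punchOut)
open import Data.Fin.Permutation as Perm using (Permutation′; _⟨$⟩ʳ_; _∘ₚ_; transpose)
import Data.Fin.Permutation.Components as PC
open import Data.Fin.Properties
  using (_≟_; +↔⊎; 0↔⊥; 1↔⊤; toℕ<n; punchInᵢ≢i; punchIn-injective; punchIn-punchOut)
import Data.Integer.Properties as ℤ
import Data.Integer.Tactic.RingSolver as ℤ-Solver
open import Data.Nat.Combinatorics
  using (_C_; nCn≡1; nCk≡nC[n∸k]; k>n⇒nCk≡0; nCk+nC[k+1]≡[n+1]C[k+1])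
import Data.Nat.Properties as ℕ
import Data.Nat.Tactic.RingSolver as ℕ-Solver
import Data.Rational.Properties as ℚ
open import Data.Rational.Unnormalised.Base as ℚᵘ using (mkℚᵘ; *≡*)
import Data.Rational.Unnormalised.Properties as ℚᵘ
open import Data.Sum.Base using (inj₁; inj₂)
open import Data.Sum.Function.Propositional using (_⊎-↔_)
open import Data.Unit.Base using (tt)
open import Data.Vec.Functional using (Vector; _∷_; _++_; tail; removeAt)
open import Data.Vec.Functional.Properties using (lookup-++ˡ; lookup-++ʳ; removeAt-punchOut)
open import Function.Base using (_∘_)
open import Function.Bundles using (_↔_; mk↔ₛ′; Inverse)
open import Function.Construct.Composition using (inverse)
open import Function.Properties.Bijection using (Bijection⇒Inverse)
open import Function.Properties.Inverse using (↔-trans)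
open import Relation.Nullary using (yes; no; contradiction)
open import Relation.Nullary.Decidable using (dec-true; dec-false)
import Algebra.Properties.AbelianGroup ℤ.+-0-abelianGroup as ℤ-Group
import Algebra.Properties.AbelianGroup ℚ.+-0-abelianGroup as ℚ-Group
open import Algebra.Properties.CommutativeMonoid.Sum ℕ.+-0-commutativeMonoid
  using () renaming ( sum to sumℕ; sum-cong-≗ to sumℕ-cong; ∑-distrib-+ to sumℕ-distrib-+
                    ; sum-permute to sumℕ-permute )
open import Algebra.Properties.CommutativeMonoid.Sum ℤ.+-0-commutativeMonoid
  using () renaming (sum to sumℤ; sum-cong-≗ to sumℤ-cong; sum-remove to sumℤ-remove)
open import Algebra.Properties.CommutativeMonoid.Sum ℚ.+-0-commutativeMonoid
  using () renaming ( sum-cong-≗ to sumℚ-cong; ∑-distrib-+ to sumℚ-distrib-+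
                    ; sum-replicate-zero to sumℚ-zero )

-- Falling factorials and binomial coefficients

-- The recursion in `fallingFactorial` peels off the last factor; Pascal's rule needs the first one,
-- `x + 1`, after which the remaining factors are those of `x`.
fallingFactorial-suc : ∀ x k → fallingFactorial (x ℤ.+ 1ℤ) (suc k) ≡ (x ℤ.+ 1ℤ) ℤ.* fallingFactorial x k
fallingFactorial-suc x zero    = swap x
  where
  swap : ∀ x → 1ℤ ℤ.* (x ℤ.+ 1ℤ ℤ.- 0ℤ) ≡ (x ℤ.+ 1ℤ) ℤ.* 1ℤ
  swap = ℤ-Solver.solve-∀
fallingFactorial-suc x (suc k) = begin
  fallingFactorial (x ℤ.+ 1ℤ) (suc k) ℤ.* (x ℤ.+ 1ℤ ℤ.- (1ℤ ℤ.+ + k))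
    ≡⟨ cong (ℤ._* (x ℤ.+ 1ℤ ℤ.- (1ℤ ℤ.+ + k))) (fallingFactorial-suc x k) ⟩
  (x ℤ.+ 1ℤ) ℤ.* fallingFactorial x k ℤ.* (x ℤ.+ 1ℤ ℤ.- (1ℤ ℤ.+ + k))
    ≡⟨ regroup x (fallingFactorial x k) (+ k) ⟩
  (x ℤ.+ 1ℤ) ℤ.* (fallingFactorial x k ℤ.* (x ℤ.- + k)) ∎
  where
  open ≡-Reasoning
  regroup : ∀ x f k → (x ℤ.+ 1ℤ) ℤ.* f ℤ.* (x ℤ.+ 1ℤ ℤ.- (1ℤ ℤ.+ k)) ≡ (x ℤ.+ 1ℤ) ℤ.* (f ℤ.* (x ℤ.- k))
  regroup = ℤ-Solver.solve-∀

-- Both sides are `x + 1` times `fallingFactorial x k`, because (x - k) + (k + 1) = x + 1.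
fallingFactorial-pascal : ∀ x k → fallingFactorial (x ℤ.+ 1ℤ) (suc k)
                        ≡ fallingFactorial x (suc k) ℤ.+ + suc k ℤ.* fallingFactorial x k
fallingFactorial-pascal x k = trans (fallingFactorial-suc x k) (regroup x (fallingFactorial x k) (+ k))
  where
  regroup : ∀ x f k → (x ℤ.+ 1ℤ) ℤ.* f ≡ f ℤ.* (x ℤ.- k) ℤ.+ (1ℤ ℤ.+ k) ℤ.* f
  regroup = ℤ-Solver.solve-∀

/-cross : ∀ i j m n .{{_ : NonZero m}} .{{_ : NonZero n}} →
          i ℤ.* + n ≡ j ℤ.* + m → i ℚ./ m ≡ j ℚ./ n
/-cross i j (suc m) (suc n) eq = ℚ.fromℚᵘ-cong {mkℚᵘ i m} {mkℚᵘ j n} (*≡* eq)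

-- The operator `ℚ./` normalises by a gcd and so blocks computation; over unnormalised fractions the
-- claim is a polynomial identity.
/-distribʳ-+ : ∀ i j m .{{_ : NonZero m}} → (i ℤ.+ j) ℚ./ m ≡ i ℚ./ m ℚ.+ j ℚ./ m
/-distribʳ-+ i j (suc m) = ℚ.toℚᵘ-injective (begin
  ℚ.toℚᵘ ((i ℤ.+ j) ℚ./ suc m)
    ≈⟨ ℚ.toℚᵘ-fromℚᵘ (mkℚᵘ (i ℤ.+ j) m) ⟩
  mkℚᵘ (i ℤ.+ j) m
    ≈⟨ *≡* (common i j (+ suc m)) ⟩
  mkℚᵘ i m ℚᵘ.+ mkℚᵘ j m
    ≈⟨ ℚᵘ.+-cong (ℚ.toℚᵘ-fromℚᵘ (mkℚᵘ i m)) (ℚ.toℚᵘ-fromℚᵘ (mkℚᵘ j m)) ⟨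
  ℚ.toℚᵘ (i ℚ./ suc m) ℚᵘ.+ ℚ.toℚᵘ (j ℚ./ suc m)
    ≈⟨ ℚ.toℚᵘ-homo-+ (i ℚ./ suc m) (j ℚ./ suc m) ⟨
  ℚ.toℚᵘ (i ℚ./ suc m ℚ.+ j ℚ./ suc m) ∎)
  where
  open ℚᵘ.≃-Reasoning
  common : ∀ i j m → (i ℤ.+ j) ℤ.* (m ℤ.* m) ≡ (i ℤ.* m ℤ.+ j ℤ.* m) ℤ.* m
  common = ℤ-Solver.solve-∀

-- Arbitrary integers are needed: the upper argument N - 1 is -1 at N = 0, and the shift in
-- `vandermonde` makes the lower one negative. For positive `z` this is `fallingFactorial-pascal`
-- divided by (k + 1)!.
binom-pascal : ∀ x z → binom (x ℤ.+ 1ℤ) z ≡ binom x z ℚ.+ binom x (z ℤ.- 1ℤ)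
binom-pascal x -[1+ k ]  = refl
binom-pascal x (+ zero)  = refl
binom-pascal x (+ suc k) = begin
  fallingFactorial (x ℤ.+ 1ℤ) (suc k) ℚ./ (suc k !)
    ≡⟨ ℚ./-cong (fallingFactorial-pascal x k) refl ⟩
  (fallingFactorial x (suc k) ℤ.+ + suc k ℤ.* fallingFactorial x k) ℚ./ (suc k !)
    ≡⟨ /-distribʳ-+ (fallingFactorial x (suc k)) (+ suc k ℤ.* fallingFactorial x k) (suc k !) ⟩
  binom x (+ suc k) ℚ.+ (+ suc k ℤ.* fallingFactorial x k) ℚ./ (suc k !)
    ≡⟨ cong (binom x (+ suc k) ℚ.+_)
         (/-cross (+ suc k ℤ.* fallingFactorial x k) (fallingFactorial x k) (suc k !) (k !) cancel) ⟩
  binom x (+ suc k) ℚ.+ binom x (+ k) ∎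
  where
  open ≡-Reasoning
  instance
    _ = k ℕ.!≢0
    _ = suc k ℕ.!≢0
  regroup : ∀ a f b → a ℤ.* f ℤ.* b ≡ f ℤ.* (a ℤ.* b)
  regroup = ℤ-Solver.solve-∀
  cancel : + suc k ℤ.* fallingFactorial x k ℤ.* + (k !) ≡ fallingFactorial x k ℤ.* + (suc k !)
  cancel = trans (regroup (+ suc k) (fallingFactorial x k) (+ (k !)))
                 (cong (fallingFactorial x k ℤ.*_) (sym (ℤ.pos-* (suc k) (k !))))

fallingFactorial-zero : ∀ k → fallingFactorial 0ℤ (suc k) ≡ 0ℤ
fallingFactorial-zero zero    = refl
fallingFactorial-zero (suc k) = cong (ℤ._* (0ℤ ℤ.- + suc k)) (fallingFactorial-zero k)

nC0≡1 : ∀ n → n C 0 ≡ 1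
nC0≡1 n = trans (nCk≡nC[n∸k] {0} {n} ℕ.z≤n) (nCn≡1 n)

-- Both sides obey Pascal's rule, so only boundary values need comparing; at upper argument 0 and
-- positive lower argument the falling factorial contains the factor 0.
binom≡C : ∀ n k → binom (+ n) (+ k) ≡ + (n C k) ℚ./ 1
binom≡C n zero = cong (λ c → + c ℚ./ 1) (sym (nC0≡1 n))
binom≡C zero (suc k) = trans
  (ℚ./-cong (fallingFactorial-zero k) refl)
  (/-cross 0ℤ 0ℤ (suc k !) 1 refl)
  where instance _ = suc k ℕ.!≢0
binom≡C (suc n) (suc k) = begin
  binom (+ suc n) (+ suc k)
    ≡⟨ cong (λ m → binom (+ m) (+ suc k)) (ℕ.+-comm 1 n) ⟩
  binom (+ n ℤ.+ 1ℤ) (+ suc k)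
    ≡⟨ binom-pascal (+ n) (+ suc k) ⟩
  binom (+ n) (+ suc k) ℚ.+ binom (+ n) (+ k)
    ≡⟨ cong₂ ℚ._+_ (binom≡C n (suc k)) (binom≡C n k) ⟩
  + (n C suc k) ℚ./ 1 ℚ.+ + (n C k) ℚ./ 1
    ≡⟨ /-distribʳ-+ (+ (n C suc k)) (+ (n C k)) 1 ⟨
  + (n C suc k + n C k) ℚ./ 1
    ≡⟨ cong (λ c → + c ℚ./ 1) (trans (ℕ.+-comm (n C suc k) (n C k)) (nCk+nC[k+1]≡[n+1]C[k+1] n k)) ⟩
  + (suc n C suc k) ℚ./ 1 ∎
  where open ≡-Reasoning

binom-negative : ∀ x {z} → z ℤ.< 0ℤ → binom x z ≡ 0ℚ
binom-negative x ℤ.-<+ = refl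

-- Sums and Vandermonde's identity

sumFrom1To-last : ∀ n f → sumFrom1To (suc n) f ≡ sumFrom1To n f ℚ.+ f (suc n)
sumFrom1To-last zero    f = ℚ.+-comm (f 1) 0ℚ
sumFrom1To-last (suc n) f = begin
  f 1 ℚ.+ sumFrom1To (suc n) (λ m → f (suc m))
    ≡⟨ cong (f 1 ℚ.+_) (sumFrom1To-last n (λ m → f (suc m))) ⟩
  f 1 ℚ.+ (sumFrom1To n (λ m → f (suc m)) ℚ.+ f (suc (suc n)))
    ≡⟨ ℚ.+-assoc (f 1) _ _ ⟨
  sumFrom1To (suc n) f ℚ.+ f (suc (suc n)) ∎
  where open ≡-Reasoning

sumFrom1To-cong : ∀ n {f g : ℕ → ℚ} → (∀ m → m ≤ n → f m ≡ g m) → sumFrom1To n f ≡ sumFrom1To n g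
sumFrom1To-cong n f≡g = sumℚ-cong {n} (λ i → f≡g (suc (toℕ i)) (toℕ<n i))

sumFrom1To-distrib-+ : ∀ n f g → sumFrom1To n (λ m → f m ℚ.+ g m) ≡ sumFrom1To n f ℚ.+ sumFrom1To n g
sumFrom1To-distrib-+ n f g = sumℚ-distrib-+ {n} _ _

sumFrom1To-last-zero : ∀ n {f} → f (suc n) ≡ 0ℚ → sumFrom1To (suc n) f ≡ sumFrom1To n f
sumFrom1To-last-zero n {f} fₙ≡0 =
  trans (sumFrom1To-last n f) (trans (cong (sumFrom1To n f ℚ.+_) fₙ≡0) (ℚ.+-identityʳ _))

-- The shift s lets the induction on y turn Pascal's rule into the cases (y , s) and (y , s + 1),
-- which share the same x + y; the case y = s = 0 is 0 = 0.
vandermonde : ∀ x y s {M} → M ≡ y + s →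
  sumFrom1To M (λ m → binom (+ y) (+ m ℤ.- + s) ℚ.* binom x (+ m ℤ.- 1ℤ))
    ≡ binom (x ℤ.+ + y) (+ M ℤ.- 1ℤ)
vandermonde x zero zero    refl = refl
vandermonde x zero (suc t) refl = begin
  sumFrom1To (suc t) f
    -- For y = 0 the factor `binom 0ℤ (m − s)` is 0 when m < s and 1 when m = s, so only the last
    -- term survives.
    ≡⟨ sumFrom1To-last t f ⟩
  sumFrom1To t f ℚ.+ f (suc t)
    ≡⟨ cong₂ ℚ._+_ (trans (sumFrom1To-cong t vanish) (sumℚ-zero t)) top ⟩
  0ℚ ℚ.+ binom x (+ suc t ℤ.- 1ℤ)
    ≡⟨ ℚ.+-identityˡ _ ⟩
  binom x (+ suc t ℤ.- 1ℤ)
    ≡⟨ cong (λ w → binom w (+ suc t ℤ.- 1ℤ)) (ℤ.+-identityʳ x) ⟨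
  binom (x ℤ.+ + 0) (+ suc t ℤ.- 1ℤ) ∎
  where
  open ≡-Reasoning
  f : ℕ → ℚ
  f m = binom 0ℤ (+ m ℤ.- + suc t) ℚ.* binom x (+ m ℤ.- 1ℤ)
  vanish : ∀ m → m ≤ t → f m ≡ 0ℚ
  vanish m m≤t = trans
    (cong (ℚ._* binom x (+ m ℤ.- 1ℤ)) (binom-negative 0ℤ
      (subst (+ m ℤ.- + suc t ℤ.<_) (ℤ.+-inverseʳ (+ suc t)) (ℤ.+-monoˡ-< (ℤ.- + suc t) (ℤ.+<+ (s≤s m≤t))))))
    (ℚ.*-zeroˡ (binom x (+ m ℤ.- 1ℤ)))
  top : f (suc t) ≡ binom x (+ suc t ℤ.- 1ℤ)
  top = trans (cong (λ z → binom 0ℤ z ℚ.* binom x (+ suc t ℤ.- 1ℤ)) (ℤ.+-inverseʳ (+ suc t)))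
              (ℚ.*-identityˡ _)
vandermonde x (suc y) s refl = begin
  sumFrom1To M (λ m → binom (+ suc y) (+ m ℤ.- + s) ℚ.* c m)
    ≡⟨ sumFrom1To-cong M (λ m _ → split m) ⟩
  sumFrom1To M (λ m → f m ℚ.+ g m)
    ≡⟨ sumFrom1To-distrib-+ M f g ⟩
  sumFrom1To M f ℚ.+ sumFrom1To M g
    -- The `f`-sum has one term more than the induction hypothesis covers; in that term, m = M, the
    -- lower argument of the first factor is y + 1 > y.
    ≡⟨ cong₂ ℚ._+_ (trans (sumFrom1To-last-zero (y + s) {f} top) (vandermonde x y s refl))
                   (vandermonde x y (suc s) (sym (ℕ.+-suc y s))) ⟩
  binom (x ℤ.+ + y) (+ (y + s) ℤ.- 1ℤ) ℚ.+ binom (x ℤ.+ + y) (+ M ℤ.- 1ℤ)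
    ≡⟨ ℚ.+-comm (binom (x ℤ.+ + y) (+ (y + s) ℤ.- 1ℤ)) _ ⟩
  binom (x ℤ.+ + y) (+ M ℤ.- 1ℤ) ℚ.+ binom (x ℤ.+ + y) (+ (y + s) ℤ.- 1ℤ)
    ≡⟨ binom-pascal (x ℤ.+ + y) (+ (y + s)) ⟨
  binom (x ℤ.+ + y ℤ.+ 1ℤ) (+ (y + s))
    ≡⟨ cong (λ w → binom w (+ (y + s))) (shift x (+ y)) ⟩
  binom (x ℤ.+ + suc y) (+ M ℤ.- 1ℤ) ∎
  where
  open ≡-Reasoning
  M = suc (y + s)
  c f g : ℕ → ℚ
  c m = binom x (+ m ℤ.- 1ℤ)
  f m = binom (+ y) (+ m ℤ.- + s) ℚ.* c m
  g m = binom (+ y) (+ m ℤ.- + suc s) ℚ.* c m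
  shift : ∀ x y → x ℤ.+ y ℤ.+ 1ℤ ≡ x ℤ.+ (1ℤ ℤ.+ y)
  shift = ℤ-Solver.solve-∀
  pred-difference : ∀ m s → m ℤ.- s ℤ.- 1ℤ ≡ m ℤ.- (1ℤ ℤ.+ s)
  pred-difference = ℤ-Solver.solve-∀
  split : ∀ m → binom (+ suc y) (+ m ℤ.- + s) ℚ.* c m ≡ f m ℚ.+ g m
  split m = begin
    binom (+ suc y) (+ m ℤ.- + s) ℚ.* c m
      ≡⟨ cong (λ n → binom (+ n) (+ m ℤ.- + s) ℚ.* c m) (ℕ.+-comm 1 y) ⟩
    binom (+ y ℤ.+ 1ℤ) (+ m ℤ.- + s) ℚ.* c m
      ≡⟨ cong (ℚ._* c m) (binom-pascal (+ y) (+ m ℤ.- + s)) ⟩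
    (binom (+ y) (+ m ℤ.- + s) ℚ.+ binom (+ y) (+ m ℤ.- + s ℤ.- 1ℤ)) ℚ.* c m
      ≡⟨ ℚ.*-distribʳ-+ (c m) (binom (+ y) (+ m ℤ.- + s)) _ ⟩
    f m ℚ.+ binom (+ y) (+ m ℤ.- + s ℤ.- 1ℤ) ℚ.* c m
      ≡⟨ cong (λ z → f m ℚ.+ binom (+ y) z ℚ.* c m) (pred-difference (+ m) (+ s)) ⟩
    f m ℚ.+ g m ∎
  cancel : ∀ y s → 1ℤ ℤ.+ (y ℤ.+ s) ℤ.- s ≡ 1ℤ ℤ.+ y
  cancel = ℤ-Solver.solve-∀
  top : f M ≡ 0ℚ
  top = begin
    binom (+ y) (+ M ℤ.- + s) ℚ.* c M ≡⟨ cong (λ z → binom (+ y) z ℚ.* c M) (cancel (+ y) (+ s)) ⟩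
    binom (+ y) (+ suc y) ℚ.* c M     ≡⟨ cong (ℚ._* c M) (binom≡C y (suc y)) ⟩
    + (y C suc y) ℚ./ 1 ℚ.* c M       ≡⟨ cong (λ n → + n ℚ./ 1 ℚ.* c M) (k>n⇒nCk≡0 (ℕ.n<1+n y)) ⟩
    0ℚ ℚ.* c M                        ≡⟨ ℚ.*-zeroˡ (c M) ⟩
    0ℚ                                ∎

-- The closed form is an addition in ℕ, which avoids truncated subtraction; accordingly `V` is added
-- to both sides and cancelled in ℚ. `vandermonde` evaluates the two sums at x = N - 1, with (y , s)
-- equal to (2d , 0) and (d , d). Both need the range 1 to 2d; the extra term m = 2d is dropped at
-- the end, its coefficient being 1 - 1.
closedForm⇒formula : ∀ d′ N → let d = suc d′ in ∀ g → g + (N + d′) C (d + d′) ≡ (N + (d + d′)) C (d + d′) →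
  + g ℚ./ 1 ≡ sumFrom1To (2 * d ∸ 1) (λ m →
    (binom (+ (2 * d)) (+ m) ℚ.- binom (+ d) (+ m ℤ.- + d)) ℚ.* binom (+ N ℤ.- 1ℤ) (+ m ℤ.- 1ℤ))
closedForm⇒formula d′ N g g+v≡u = trans (ℚ-Group.∙-cancelʳ V G S G+V≡S+V) (sumFrom1To-last-zero M {f} last-zero)
  where
  open ≡-Reasoning
  d = suc d′
  M = 2 * d ∸ 1
  x = + N ℤ.- 1ℤ
  a b c f : ℕ → ℚ
  a m = binom (+ (2 * d)) (+ m)
  b m = binom (+ d) (+ m ℤ.- + d)
  c m = binom x (+ m ℤ.- 1ℤ)
  f m = (a m ℚ.- b m) ℚ.* c m
  S = sumFrom1To (2 * d) f
  G = + g ℚ./ 1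
  V = sumFrom1To (2 * d) (λ m → b m ℚ.* c m)
  M≡d+d′ : M ≡ d + d′
  M≡d+d′ = trans (ℕ.+-suc d′ (d′ + 0)) (cong (λ e → suc (d′ + e)) (ℕ.+-identityʳ d′))

  shift : ∀ n y → n ℤ.- 1ℤ ℤ.+ (1ℤ ℤ.+ y) ≡ n ℤ.+ y
  shift = ℤ-Solver.solve-∀

  V≡C : V ≡ + ((N + d′) C (d + d′)) ℚ./ 1
  V≡C = begin
    V                                 ≡⟨ vandermonde x d d (cong (λ e → d + e) (ℕ.+-identityʳ d)) ⟩
    binom (x ℤ.+ + d) (+ M)           ≡⟨ cong (λ z → binom z (+ M)) (shift (+ N) (+ d′)) ⟩
    binom (+ (N + d′)) (+ M)          ≡⟨ binom≡C (N + d′) M ⟩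
    + ((N + d′) C M) ℚ./ 1            ≡⟨ cong (λ k → + ((N + d′) C k) ℚ./ 1) M≡d+d′ ⟩
    + ((N + d′) C (d + d′)) ℚ./ 1     ∎

  U≡C : sumFrom1To (2 * d) (λ m → a m ℚ.* c m) ≡ + ((N + (d + d′)) C (d + d′)) ℚ./ 1
  U≡C = begin
    sumFrom1To (2 * d) (λ m → a m ℚ.* c m)
      ≡⟨ sumFrom1To-cong (2 * d) (λ m _ →
           cong (λ z → binom (+ (2 * d)) z ℚ.* c m) (sym (ℤ.+-identityʳ (+ m)))) ⟩
    sumFrom1To (2 * d) (λ m → binom (+ (2 * d)) (+ m ℤ.- 0ℤ) ℚ.* c m)
      ≡⟨ vandermonde x (2 * d) 0 (sym (ℕ.+-identityʳ (2 * d))) ⟩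
    binom (x ℤ.+ + (2 * d)) (+ M)     ≡⟨ cong (λ z → binom z (+ M)) (shift (+ N) (+ M)) ⟩
    binom (+ (N + M)) (+ M)           ≡⟨ binom≡C (N + M) M ⟩
    + ((N + M) C M) ℚ./ 1             ≡⟨ cong (λ k → + ((N + k) C k) ℚ./ 1) M≡d+d′ ⟩
    + ((N + (d + d′)) C (d + d′)) ℚ./ 1 ∎

  recombine : ∀ m → a m ℚ.* c m ≡ f m ℚ.+ b m ℚ.* c m
  recombine m = begin
    a m ℚ.* c m                             ≡⟨ cong (ℚ._* c m) (ℚ.+-identityʳ (a m)) ⟨
    (a m ℚ.+ 0ℚ) ℚ.* c m                    ≡⟨ cong (λ q → (a m ℚ.+ q) ℚ.* c m) (ℚ.+-inverseˡ (b m)) ⟨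
    (a m ℚ.+ (ℚ.- b m ℚ.+ b m)) ℚ.* c m     ≡⟨ cong (ℚ._* c m) (ℚ.+-assoc (a m) _ _) ⟨
    (a m ℚ.- b m ℚ.+ b m) ℚ.* c m           ≡⟨ ℚ.*-distribʳ-+ (c m) (a m ℚ.- b m) (b m) ⟩
    f m ℚ.+ b m ℚ.* c m                     ∎

  G+V≡S+V : G ℚ.+ V ≡ S ℚ.+ V
  G+V≡S+V = begin
    G ℚ.+ V                                          ≡⟨ cong (G ℚ.+_) V≡C ⟩
    G ℚ.+ + ((N + d′) C (d + d′)) ℚ./ 1              ≡⟨ /-distribʳ-+ (+ g) (+ ((N + d′) C (d + d′))) 1 ⟨
    + (g + (N + d′) C (d + d′)) ℚ./ 1                ≡⟨ cong (λ n → + n ℚ./ 1) g+v≡u ⟩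
    + ((N + (d + d′)) C (d + d′)) ℚ./ 1              ≡⟨ U≡C ⟨
    sumFrom1To (2 * d) (λ m → a m ℚ.* c m)           ≡⟨ sumFrom1To-cong (2 * d) (λ m _ → recombine m) ⟩
    sumFrom1To (2 * d) (λ m → f m ℚ.+ b m ℚ.* c m)   ≡⟨ sumFrom1To-distrib-+ (2 * d) f (λ m → b m ℚ.* c m) ⟩
    S ℚ.+ V                                          ∎

  binom-self : ∀ n → binom (+ n) (+ n) ≡ 1ℚ
  binom-self n = trans (binom≡C n n) (cong (λ k → + k ℚ./ 1) (nCn≡1 n))

  half : + (2 * d) ℤ.- + d ≡ + d
  half = trans (cong (λ n → + (d + n) ℤ.- + d) (ℕ.+-identityʳ d)) (double (+ d))
    where
    double : ∀ z → z ℤ.+ z ℤ.- z ≡ z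
    double = ℤ-Solver.solve-∀

  last-zero : f (suc M) ≡ 0ℚ
  last-zero = begin
    (a (2 * d) ℚ.- b (2 * d)) ℚ.* c (2 * d)
      ≡⟨ cong₂ (λ p q → (p ℚ.- q) ℚ.* c (2 * d)) (binom-self (2 * d))
               (trans (cong (binom (+ d)) half) (binom-self d)) ⟩
    (1ℚ ℚ.- 1ℚ) ℚ.* c (2 * d)   ≡⟨ ℚ.*-zeroˡ (c (2 * d)) ⟩
    0ℚ                          ∎

-- Weak compositions of n into k parts, as lattice paths

data Composition : (k n : ℕ) → Set where
  []    : Composition 0 0
  zero∷ : ∀ {k n} → Composition k n → Composition (suc k) n
  incr  : ∀ {k n} → Composition (suc k) n → Composition (suc k) (suc n)

-- Whether the first part is 0 determines the outermost constructor, so every vector comes from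
-- exactly one path. As the total is an index and no proof is stored, equality of paths amounts to
-- equality of parts.
parts : ∀ {k n} → Composition k n → Vector ℕ k
parts (zero∷ w) zero    = 0
parts (zero∷ w) (suc i) = parts w i
parts (incr w)  zero    = suc (parts w zero)
parts (incr w)  (suc i) = parts w (suc i)

sum-parts : ∀ {k n} (w : Composition k n) → sumℕ (parts w) ≡ n
sum-parts []        = refl
sum-parts (zero∷ w) = sum-parts w
sum-parts (incr w)  = cong suc (sum-parts w)

parts-injective : ∀ {k n} (w w′ : Composition k n) → parts w ≗ parts w′ → w ≡ w′
parts-injective []        []         eq = refl
parts-injective (zero∷ w) (zero∷ w′) eq = cong zero∷ (parts-injective w w′ (eq ∘ suc))
parts-injective (zero∷ w) (incr w′)  eq = contradiction (eq zero) λ ()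
parts-injective (incr w)  (zero∷ w′) eq = contradiction (eq zero) λ ()
parts-injective (incr w)  (incr w′)  eq = cong incr (parts-injective w w′
  λ { zero → ℕ.suc-injective (eq zero) ; (suc i) → eq (suc i) })

parts-surjective : ∀ k n (v : Vector ℕ k) → sumℕ v ≡ n → ∃ λ (w : Composition k n) → parts w ≗ v
parts-surjective zero    _ v refl = [] , λ ()
parts-surjective (suc k) n v eq = go n (v zero) refl eq
  where
  -- Recursion on the value `x` of the first entry, one `incr` per unit; stating `v zero ≡ x` as an
  -- equation lets `x` decrease structurally.
  go : ∀ n x {v : Vector ℕ (suc k)} → v zero ≡ x → sumℕ v ≡ n → ∃ λ (w : Composition (suc k) n) → parts w ≗ v
  go n zero {v} v₀≡0 eq with w , w≗ ←
      parts-surjective k n (tail v) (trans (cong (_+ sumℕ (tail v)) (sym v₀≡0)) eq)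
    = zero∷ w , λ { zero → sym v₀≡0 ; (suc i) → w≗ i }
  go zero    (suc x) {v} v₀≡ eq = contradiction (trans (cong (_+ sumℕ (tail v)) (sym v₀≡)) eq) λ ()
  go (suc n) (suc x) {v} v₀≡ eq with w , w≗ ←
      go n x {x ∷ tail v} refl (ℕ.suc-injective (trans (cong (_+ sumℕ (tail v)) (sym v₀≡)) eq))
    = incr w , λ { zero → trans (cong suc (w≗ zero)) (sym v₀≡) ; (suc i) → w≗ (suc i) }

#Composition : ℕ → ℕ → ℕ
#Composition zero    zero    = 1
#Composition zero    (suc n) = 0
#Composition (suc k) zero    = #Composition k 0
#Composition (suc k) (suc n) = #Composition k (suc n) + #Composition (suc k) n

Composition-finite : ∀ k n → Fin (#Composition k n) ↔ Composition k n
Composition-finite zero zero =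
  ↔-trans 1↔⊤ (mk↔ₛ′ (λ _ → []) (λ _ → tt) (λ { [] → refl }) (λ _ → refl))
Composition-finite zero (suc n) = ↔-trans 0↔⊥ (mk↔ₛ′ ⊥-elim (λ ()) (λ ()) (λ ()))
Composition-finite (suc k) zero =
  ↔-trans (Composition-finite k 0) (mk↔ₛ′ zero∷ (λ { (zero∷ w) → w }) (λ { (zero∷ w) → refl }) (λ _ → refl))
Composition-finite (suc k) (suc n) =
  ↔-trans (↔-trans +↔⊎ (Composition-finite k (suc n) ⊎-↔ Composition-finite (suc k) n))
    (mk↔ₛ′ (λ { (inj₁ w) → zero∷ w ; (inj₂ w) → incr w }) (λ { (zero∷ w) → inj₁ w ; (incr w) → inj₂ w })
      (λ { (zero∷ w) → refl ; (incr w) → refl }) (λ { (inj₁ w) → refl ; (inj₂ w) → refl }))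

#Composition-zero : ∀ k → #Composition k 0 ≡ 1
#Composition-zero zero    = refl
#Composition-zero (suc k) = #Composition-zero k

-- Stars and bars: the two constructors give the two summands of Pascal's rule. Writing the number
-- of parts as q + 1 avoids a truncated predecessor.
#Composition-C : ∀ q n → #Composition (suc q) n ≡ (n + q) C q
#Composition-C q       zero    = trans (#Composition-zero q) (sym (nCn≡1 q))
#Composition-C zero    (suc n) = trans (#Composition-C zero n) (trans (nC0≡1 (n + 0)) (sym (nC0≡1 (suc n + 0))))
#Composition-C (suc q) (suc n) = begin
  #Composition (suc q) (suc n) + #Composition (suc (suc q)) n
    ≡⟨ cong₂ _+_ (#Composition-C q (suc n)) (#Composition-C (suc q) n) ⟩
  (suc n + q) C q + (n + suc q) C suc q
    ≡⟨ cong (λ m → m C q + (n + suc q) C suc q) (ℕ.+-suc n q) ⟨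
  (n + suc q) C q + (n + suc q) C suc q
    ≡⟨ nCk+nC[k+1]≡[n+1]C[k+1] (n + suc q) q ⟩
  (suc n + suc q) C suc q ∎
  where open ≡-Reasoning

-- Pairs (r , c) ∈ ℕᵃ × ℕᵖ of total n such that r has an entry 0, organised by the position of
-- the first such entry. In the constructor later, the positive entry r₀ is unconstrained once
-- decremented, so r₀ − 1 is stored as an additional first entry of c.
data Marked : (a p n : ℕ) → Set where
  first : ∀ {a p n} → Composition (a + p) n → Marked (suc a) p n
  later : ∀ {a p n} → Marked a (suc p) n → Marked (suc a) p (suc n)

rows : ∀ {a p n} → Marked a p n → Vector ℕ a
cols : ∀ {a p n} → Marked a p n → Vector ℕ p
rows             (first w) zero    = 0
rows {suc a} {p} (first w) (suc i) = parts w (i ↑ˡ p)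
rows             (later z) zero    = suc (cols z zero)
rows             (later z) (suc i) = rows z i
cols {suc a}     (first w) j       = parts w (a ↑ʳ j)
cols             (later z) j       = cols z (suc j)

sum-split : ∀ a p (v : Vector ℕ (a + p)) → sumℕ v ≡ sumℕ (λ i → v (i ↑ˡ p)) + sumℕ (λ j → v (a ↑ʳ j))
sum-split zero    p v = refl
sum-split (suc a) p v = trans (cong (λ s → v zero + s) (sum-split a p (tail v))) (sym (ℕ.+-assoc (v zero) _ _))

sum-rows-cols : ∀ {a p n} (z : Marked a p n) → sumℕ (rows z) + sumℕ (cols z) ≡ n
sum-rows-cols {suc a} {p} (first w) = trans (sym (sum-split a p (parts w))) (sum-parts w)
sum-rows-cols (later z) = cong suc (trans
  (regroup (cols z zero) (sumℕ (rows z)) (sumℕ (tail (cols z)))) (sum-rows-cols z))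
  where
  regroup : ∀ x y z → x + y + z ≡ y + (x + z)
  regroup = ℕ-Solver.solve-∀

rows-zero : ∀ {a p n} (z : Marked a p n) → ∃ λ i → rows z i ≡ 0
rows-zero (first w) = zero , refl
rows-zero (later z) with i , eq ← rows-zero z = suc i , eq

split-≗ : ∀ a {p} {u v : Vector ℕ (a + p)} →
  (λ i → u (i ↑ˡ p)) ≗ (λ i → v (i ↑ˡ p)) → (λ j → u (a ↑ʳ j)) ≗ (λ j → v (a ↑ʳ j)) → u ≗ v
split-≗ zero    l r i       = r i
split-≗ (suc a) l r zero    = l zero
split-≗ (suc a) l r (suc i) = split-≗ a (l ∘ suc) r i

rows-cols-injective : ∀ {a p n} (z z′ : Marked a p n) → rows z ≗ rows z′ → cols z ≗ cols z′ → z ≡ z′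
rows-cols-injective {suc a} (first w) (first w′) r c = cong first (parts-injective w w′ (split-≗ a (r ∘ suc) c))
rows-cols-injective (first w) (later z) r c = contradiction (r zero) λ ()
rows-cols-injective (later z) (first w) r c = contradiction (r zero) λ ()
rows-cols-injective (later z) (later z′) r c = cong later (rows-cols-injective z z′ (r ∘ suc)
  λ { zero → ℕ.suc-injective (r zero) ; (suc j) → c j })

-- Rows are read off up to the first 0; a head x + 1 becomes a `later` and hands x over to the front
-- of `c`. The index of a zero is carried along because a positive head forces it into the tail, so
-- the rows cannot run out before a zero is met.
rows-cols-surjective : ∀ a p n (r : Vector ℕ a) (c : Vector ℕ p) → ∃ (λ i → r i ≡ 0) → sumℕ r + sumℕ c ≡ n →
  ∃ λ (z : Marked a p n) → rows z ≗ r × cols z ≗ c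
rows-cols-surjective (suc a) p n r c (i , rᵢ≡0) eq = go n (r zero) refl i rᵢ≡0 eq
  where
  open ≡-Reasoning
  sum-++ : r zero ≡ 0 → sumℕ (tail r ++ c) ≡ sumℕ r + sumℕ c
  sum-++ r₀≡0 = begin
    sumℕ (tail r ++ c)
      ≡⟨ sum-split a p (tail r ++ c) ⟩
    sumℕ (λ i → (tail r ++ c) (i ↑ˡ p)) + sumℕ (λ j → (tail r ++ c) (a ↑ʳ j))
      ≡⟨ cong₂ _+_ (sumℕ-cong (lookup-++ˡ (tail r) c)) (sumℕ-cong (lookup-++ʳ (tail r) c)) ⟩
    sumℕ (tail r) + sumℕ c
      ≡⟨ cong (λ x → x + sumℕ (tail r) + sumℕ c) r₀≡0 ⟨
    sumℕ r + sumℕ c ∎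
  regroup : ∀ x y z → x + (y + z) ≡ y + x + z
  regroup = ℕ-Solver.solve-∀
  go : ∀ n x → r zero ≡ x → ∀ i → r i ≡ 0 → sumℕ r + sumℕ c ≡ n →
    ∃ λ (z : Marked (suc a) p n) → rows z ≗ r × cols z ≗ c
  go n zero r₀≡0 _ _ eq with w , w≗ ← parts-surjective (a + p) n (tail r ++ c) (trans (sum-++ r₀≡0) eq)
    = first w , (λ { zero → sym r₀≡0 ; (suc i) → trans (w≗ (i ↑ˡ p)) (lookup-++ˡ (tail r) c i) })
              , λ j → trans (w≗ (a ↑ʳ j)) (lookup-++ʳ (tail r) c j)
  go n (suc x) r₀≡ zero r₀≡0 eq = contradiction (trans (sym r₀≡) r₀≡0) λ ()
  go zero (suc x) r₀≡ (suc i) rᵢ≡0 eq =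
    contradiction (trans (cong (λ x → x + sumℕ (tail r) + sumℕ c) (sym r₀≡)) eq) λ ()
  go (suc n) (suc x) r₀≡ (suc i) rᵢ≡0 eq with z , r≗ , c≗ ←
      rows-cols-surjective a (suc p) n (tail r) (x ∷ c) (i , rᵢ≡0)
        (trans (regroup (sumℕ (tail r)) x (sumℕ c))
          (ℕ.suc-injective (trans (cong (λ x → x + sumℕ (tail r) + sumℕ c) (sym r₀≡)) eq)))
    = later z , (λ { zero → trans (cong suc (c≗ zero)) (sym r₀≡) ; (suc i) → r≗ i }) , c≗ ∘ suc

#Marked : ℕ → ℕ → ℕ → ℕ
#Marked zero    p n       = 0
#Marked (suc a) p zero    = #Composition (a + p) 0
#Marked (suc a) p (suc n) = #Composition (a + p) (suc n) + #Marked a (suc p) n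

Marked-finite : ∀ a p n → Fin (#Marked a p n) ↔ Marked a p n
Marked-finite zero p n = ↔-trans 0↔⊥ (mk↔ₛ′ ⊥-elim (λ ()) (λ ()) (λ ()))
Marked-finite (suc a) p zero =
  ↔-trans (Composition-finite (a + p) 0) (mk↔ₛ′ first (λ { (first w) → w }) (λ { (first w) → refl }) (λ _ → refl))
Marked-finite (suc a) p (suc n) =
  ↔-trans (↔-trans +↔⊎ (Composition-finite (a + p) (suc n) ⊎-↔ Marked-finite a (suc p) n))
    (mk↔ₛ′ (λ { (inj₁ w) → first w ; (inj₂ z) → later z }) (λ { (first w) → inj₁ w ; (later z) → inj₂ z })
      (λ { (first w) → refl ; (later z) → refl }) (λ { (inj₁ w) → refl ; (inj₂ z) → refl }))

-- Since `later` preserves a + p and lowers n by one, the count is the sum over i < a of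
-- `#Composition (a + q) (n − i)`, with terms i > n read as 0. By Pascal's rule this sum telescopes,
-- one step per induction step on `a`. The subtracted boundary term stands on the left to stay
-- within ℕ.
#Marked-C : ∀ a q n → #Marked a (suc q) n + (n + q) C (a + q) ≡ (n + (a + q)) C (a + q)
#Marked-C zero    q n    = refl
-- For n = 0 only the zero composition is left, and the subtracted binomial coefficient vanishes
-- since q < a + 1 + q.
#Marked-C (suc a) q zero = trans
  (cong₂ _+_ (#Composition-zero (a + suc q)) (k>n⇒nCk≡0 (ℕ.s≤s (ℕ.m≤n+m q a)))) (sym (nCn≡1 (suc a + q)))
#Marked-C (suc a) q (suc n) = begin
  #Composition (a + suc q) (suc n) + #Marked a (2 + q) n + (suc n + q) C suc (a + q)
    ≡⟨ ℕ.+-assoc (#Composition (a + suc q) (suc n)) _ _ ⟩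
  #Composition (a + suc q) (suc n) + (#Marked a (2 + q) n + (suc n + q) C suc (a + q))
    -- The subtracted term is the same for (a + 1 , q , n + 1) as for (a , q + 1 , n), so up to
    -- `+-suc` it is the one in the induction hypothesis.
    ≡⟨ cong₂ (λ k m → #Composition k (suc n) + (#Marked a (2 + q) n + m)) (ℕ.+-suc a q)
         (cong₂ _C_ (sym (ℕ.+-suc n q)) (sym (ℕ.+-suc a q))) ⟩
  #Composition (suc (a + q)) (suc n) + (#Marked a (2 + q) n + (n + suc q) C (a + suc q))
    ≡⟨ cong₂ _+_ (#Composition-C (a + q) (suc n)) (#Marked-C a (suc q) n) ⟩
  (suc n + (a + q)) C (a + q) + (n + (a + suc q)) C (a + suc q)
    ≡⟨ cong (λ k → (suc n + (a + q)) C (a + q) + (n + k) C k) (ℕ.+-suc a q) ⟩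
  (suc n + (a + q)) C (a + q) + (n + suc (a + q)) C suc (a + q)
    ≡⟨ cong (λ m → m C (a + q) + (n + suc (a + q)) C suc (a + q)) (ℕ.+-suc n (a + q)) ⟨
  (n + suc (a + q)) C (a + q) + (n + suc (a + q)) C suc (a + q)
    ≡⟨ nCk+nC[k+1]≡[n+1]C[k+1] (n + suc (a + q)) (a + q) ⟩
  (suc n + (suc a + q)) C (suc a + q) ∎
  where open ≡-Reasoning

-- G-matrices

transpose-left : ∀ {n} (i j : Fin n) → PC.transpose i j i ≡ j
transpose-left i j rewrite dec-true (i ≟ i) refl = refl

transpose-right : ∀ {n} (i j : Fin n) → PC.transpose i j j ≡ i
transpose-right i j with j ≟ i
... | yes j≡i = j≡i
... | no _ rewrite dec-true (j ≟ j) refl = refl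

transpose-fixed : ∀ {n} (i j : Fin n) {x} → x ≢ i → x ≢ j → PC.transpose i j x ≡ x
transpose-fixed i j {x} x≢i x≢j rewrite dec-false (x ≟ i) x≢i | dec-false (x ≟ j) x≢j = refl

-- The first transposition takes `i` to `j` and `k` to `k′`; the second takes `k′` to `l` and leaves
-- `j` in place, because `j ≢ l` and, by injectivity, `j ≢ k′`.
∃-permutation : ∀ {n} {i k j l : Fin n} → i ≢ k → j ≢ l →
  ∃ λ (σ : Permutation′ n) → σ ⟨$⟩ʳ i ≡ j × σ ⟨$⟩ʳ k ≡ l
∃-permutation {i = i} {k} {j} {l} i≢k j≢l = transpose i j ∘ₚ transpose k′ l
  , trans (cong (PC.transpose k′ l) (transpose-left i j)) (transpose-fixed k′ l j≢k′ j≢l)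
  , transpose-left k′ l
  where
  k′ = PC.transpose i j k
  j≢k′ : j ≢ k′
  j≢k′ j≡k′ = i≢k (begin
    i                     ≡⟨ transpose-left j i ⟨
    PC.transpose j i j    ≡⟨ cong (PC.transpose j i) j≡k′ ⟩
    PC.transpose j i k′   ≡⟨ PC.transpose-inverse j i ⟩
    k                     ∎)
    where open ≡-Reasoning

-- Removing positions `i` and `k` leaves equal remainders, which cancel. The index `k′` is where `k`
-- sits once `i` has been removed. Removing twice needs length at least two; length one contradicts
-- `i ≢ k`.
sum-exchange : ∀ {n} (f g : Vector ℤ n) {i k} → i ≢ k → (∀ x → x ≢ i → x ≢ k → f x ≡ g x) →
  sumℤ f ≡ sumℤ g → f i ℤ.+ f k ≡ g i ℤ.+ g k
sum-exchange {1} f g {zero} {zero} i≢k = contradiction refl i≢k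
sum-exchange {suc (suc n)} f g {i} {k} i≢k f≡g ∑f≡∑g = ℤ-Group.∙-cancelʳ (rest f) _ _ (begin
  f i ℤ.+ f k ℤ.+ rest f  ≡⟨ pull f ⟨
  sumℤ f                  ≡⟨ ∑f≡∑g ⟩
  sumℤ g                  ≡⟨ pull g ⟩
  g i ℤ.+ g k ℤ.+ rest g  ≡⟨ cong (λ s → g i ℤ.+ g k ℤ.+ s) (sumℤ-cong λ x → f≡g _ (≢i x) (≢k x)) ⟨
  g i ℤ.+ g k ℤ.+ rest f  ∎)
  where
  open ≡-Reasoning
  k′ = punchOut i≢k
  rest : Vector ℤ (suc (suc n)) → ℤ
  rest h = sumℤ (removeAt (removeAt h i) k′)
  pull : ∀ h → sumℤ h ≡ h i ℤ.+ h k ℤ.+ rest h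
  pull h = begin
    sumℤ h                                    ≡⟨ sumℤ-remove {i = i} h ⟩
    h i ℤ.+ sumℤ (removeAt h i)               ≡⟨ cong (λ s → h i ℤ.+ s) (sumℤ-remove {i = k′} (removeAt h i)) ⟩
    h i ℤ.+ (removeAt h i k′ ℤ.+ rest h)      ≡⟨ cong (λ y → h i ℤ.+ (y ℤ.+ rest h)) (removeAt-punchOut h i≢k) ⟩
    h i ℤ.+ (h k ℤ.+ rest h)                  ≡⟨ ℤ.+-assoc (h i) (h k) (rest h) ⟨
    h i ℤ.+ h k ℤ.+ rest h                    ∎
  ≢i : ∀ x → punchIn i (punchIn k′ x) ≢ i
  ≢i x = punchInᵢ≢i i (punchIn k′ x)
  ≢k : ∀ x → punchIn i (punchIn k′ x) ≢ k
  ≢k x eq = punchInᵢ≢i k′ x (punchIn-injective i _ _ (trans eq (sym (punchIn-punchOut i≢k))))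

-- Off the degenerate cases, take σ with σ i = j and σ k = l, and let τ swap `i` and `k` before
-- applying σ. Both sums have value N and agree outside rows `i` and `k`, so `sum-exchange` leaves
-- the four entries.
exchange : ∀ {d N} {A : IntMatrix d} → IsGMatrix N A → ∀ i k j l →
  A i j ℤ.+ A k l ≡ A i l ℤ.+ A k j
exchange {A = A} G i k j l with i ≟ k | j ≟ l
... | yes refl | _        = ℤ.+-comm (A i j) (A i l)
... | no _     | yes refl = refl
... | no i≢k   | no j≢l with σ , refl , refl ← ∃-permutation i≢k j≢l = begin
  A i (σ ⟨$⟩ʳ i) ℤ.+ A k (σ ⟨$⟩ʳ k)
    ≡⟨ sum-exchange (λ x → A x (σ ⟨$⟩ʳ x)) (λ x → A x (τ ⟨$⟩ʳ x)) i≢k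
         (λ x x≢i x≢k → cong (λ y → A x (σ ⟨$⟩ʳ y)) (sym (transpose-fixed i k x≢i x≢k)))
         (trans (G.value σ) (sym (G.value τ))) ⟩
  A i (τ ⟨$⟩ʳ i) ℤ.+ A k (τ ⟨$⟩ʳ k)
    ≡⟨ cong₂ (λ x y → A i (σ ⟨$⟩ʳ x) ℤ.+ A k (σ ⟨$⟩ʳ y)) (transpose-left i k) (transpose-right i k) ⟩
  A i (σ ⟨$⟩ʳ k) ℤ.+ A k (σ ⟨$⟩ʳ i) ∎
  where
  open ≡-Reasoning
  module G = IsGMatrix G
  τ = transpose i k ∘ₚ σ

-- Decomposition of G-matrices into row and column vectors

argmin : ∀ {n} (v : Vector ℕ (suc n)) → ∃ λ k → ∀ i → v k ≤ v i
argmin {zero}  v = zero , λ { zero → ℕ.≤-refl }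
argmin {suc n} v with k , min ← argmin (tail v) with ℕ.≤-total (v zero) (v (suc k))
... | inj₁ v₀≤vₖ = zero  , λ { zero → ℕ.≤-refl ; (suc i) → ℕ.≤-trans v₀≤vₖ (min i) }
... | inj₂ vₖ≤v₀ = suc k , λ { zero → vₖ≤v₀ ; (suc i) → min i }

outerSum : ∀ {d} → Vector ℕ d → Vector ℕ d → IntMatrix d
outerSum r c i j = + (r i + c j)

sumℤ-pos : ∀ {n} (v : Vector ℕ n) → sumℤ (λ i → + v i) ≡ + sumℕ v
sumℤ-pos {zero}  v = refl
sumℤ-pos {suc n} v = cong (λ s → + v zero ℤ.+ s) (sumℤ-pos (tail v))

outerSum-isGMatrix : ∀ {d N} (r c : Vector ℕ d) → sumℕ r + sumℕ c ≡ N → IsGMatrix N (outerSum r c)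
outerSum-isGMatrix {N = N} r c eq = record
  { nonNegative = λ i j → ℤ.+≤+ ℕ.z≤n
  ; value       = λ σ → begin
      sumℤ (λ i → + (r i + c (σ ⟨$⟩ʳ i)))      ≡⟨ sumℤ-pos (λ i → r i + c (σ ⟨$⟩ʳ i)) ⟩
      + sumℕ (λ i → r i + c (σ ⟨$⟩ʳ i))        ≡⟨ cong +_ (sumℕ-distrib-+ r (λ i → c (σ ⟨$⟩ʳ i))) ⟩
      + (sumℕ r + sumℕ (λ i → c (σ ⟨$⟩ʳ i)))   ≡⟨ cong (λ s → + (sumℕ r + s)) (sumℕ-permute c σ) ⟨
      + (sumℕ r + sumℕ c)                      ≡⟨ cong +_ eq ⟩
      + N                                      ∎
  }
  where open ≡-Reasoning

-- Only a constant could move between `r` and `c`, and the zeros rule this out: at a zero of `r′`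
-- the equation gives `c j ≤ c′ j`, at a zero of `r` the reverse, wherever these zeros lie.
outerSum-injective : ∀ {d} {r c r′ c′ : Vector ℕ d} → (∃ λ i → r i ≡ 0) → (∃ λ i → r′ i ≡ 0) →
  (∀ i j → outerSum r c i j ≡ outerSum r′ c′ i j) → r ≗ r′ × c ≗ c′
outerSum-injective {d} {r} {c} {r′} {c′} (k , rₖ≡0) (l , r′ₗ≡0) eq =
  (λ i → ℕ.+-cancelʳ-≡ (c i) (r i) (r′ i) (trans (eqℕ i i) (cong (λ s → r′ i + s) (sym (c≗c′ i))))) , c≗c′
  where
  eqℕ : ∀ i j → r i + c j ≡ r′ i + c′ j
  eqℕ i j = ℤ.+-injective (eq i j)
  c≗c′ : c ≗ c′
  c≗c′ j = ℕ.≤-antisym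
    (subst (c j ≤_) (trans (eqℕ l j) (cong (_+ c′ j) r′ₗ≡0)) (ℕ.m≤n+m (c j) (r l)))
    (subst (c′ j ≤_) (trans (sym (eqℕ k j)) (cong (_+ c j) rₖ≡0)) (ℕ.m≤n+m (c′ j) (r′ k)))

-- Let `k` be a row in which column `zero` is least. Row `k` itself serves as `c`, and the excess of
-- column `zero` over its minimum as `r`; minimality makes the truncated subtraction exact, and `r`
-- vanishes at `k`.
outerSum-surjective : ∀ {d′ N} {A : IntMatrix (suc d′)} → IsGMatrix N A →
  ∃ λ r → ∃ λ c → (∃ λ i → r i ≡ 0) × sumℕ r + sumℕ c ≡ N × (∀ i j → outerSum r c i j ≡ A i j)
outerSum-surjective {d′} {N} {A} G with k , min ← argmin (λ i → ℤ.∣ A i zero ∣) =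
  r , c , (k , ℕ.n∸n≡0 (B k zero)) , ℤ.+-injective total , A≡
  where
  open ≡-Reasoning
  module G = IsGMatrix G
  B : Fin (suc d′) → Fin (suc d′) → ℕ
  B i j = ℤ.∣ A i j ∣
  r c : Vector ℕ (suc d′)
  r i = B i zero ∸ B k zero
  c j = B k j
  B≡A : ∀ i j → + B i j ≡ A i j
  B≡A i j = ℤ.0≤i⇒+∣i∣≡i (G.nonNegative i j)
  exchangeℕ : ∀ i j → B i j + B k zero ≡ B i zero + B k j
  exchangeℕ i j = ℤ.+-injective (begin
    + B i j ℤ.+ + B k zero  ≡⟨ cong₂ ℤ._+_ (B≡A i j) (B≡A k zero) ⟩
    A i j ℤ.+ A k zero      ≡⟨ exchange G i k j zero ⟩
    A i zero ℤ.+ A k j      ≡⟨ cong₂ ℤ._+_ (B≡A i zero) (B≡A k j) ⟨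
    + B i zero ℤ.+ + B k j  ∎)
  swap : ∀ x y z → x + y + z ≡ x + z + y
  swap = ℕ-Solver.solve-∀
  A≡ : ∀ i j → outerSum r c i j ≡ A i j
  A≡ i j = trans (cong +_ (ℕ.+-cancelʳ-≡ (B k zero) (r i + c j) (B i j) (begin
    r i + B k j + B k zero   ≡⟨ swap (r i) (B k j) (B k zero) ⟩
    r i + B k zero + B k j   ≡⟨ cong (_+ B k j) (ℕ.m∸n+n≡m (min i)) ⟩
    B i zero + B k j         ≡⟨ exchangeℕ i j ⟨
    B i j + B k zero         ∎))) (B≡A i j)
  total : + (sumℕ r + sumℕ c) ≡ + N
  total = begin
    + (sumℕ r + sumℕ c)           ≡⟨ cong +_ (sumℕ-distrib-+ r c) ⟨
    + sumℕ (λ i → r i + c i)      ≡⟨ sumℤ-pos (λ i → r i + c i) ⟨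
    sumℤ (λ i → + (r i + c i))    ≡⟨ sumℤ-cong (λ i → A≡ i i) ⟩
    -- The diagonal contains each `r i` and each `c i` exactly once, so the identity permutation
    -- gives the total.
    sumℤ (λ i → A i i)            ≡⟨ G.value Perm.id ⟩
    + N                           ∎

-- The bijection between marked pairs and G-matrices, and the count

Marked-GMatrices : ∀ d′ N → let d = suc d′ in Inverse (setoid (Marked d d N)) (GMatrices d N)
Marked-GMatrices d′ N = Bijection⇒Inverse record
  { to        = λ z → outerSum (rows z) (cols z) , outerSum-isGMatrix (rows z) (cols z) (sum-rows-cols z)
  ; cong      = λ { refl i j → refl }
  ; bijective = (λ {z} {z′} eq → let r≗ , c≗ = outerSum-injective (rows-zero z) (rows-zero z′) eq
                                 in rows-cols-injective z z′ r≗ c≗)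
              , λ (A , G) → let r , c , zero-row , total , rc≡A = outerSum-surjective G
                                z , r≗ , c≗ = rows-cols-surjective d d N r c zero-row total
                            -- Surjectivity is demanded for every argument equal to the preimage
                            -- `z`, hence the match on `refl`.
                            in z , λ { refl i j → trans (cong₂ (λ x y → + (x + y)) (r≗ i) (c≗ j)) (rc≡A i j) }
  }
  where d = suc d′

GMatrices-finite : ∀ d′ N → let d = suc d′ in HasCardinality (GMatrices d N) (#Marked d d N)
GMatrices-finite d′ N = inverse (Marked-finite (suc d′) (suc d′) N) (Marked-GMatrices d′ N)

mainTheorem4 : (d : ℕ) → 1 ≤ d → (N : ℕ) →
    Σ[ g ∈ ℕ ]
    ( HasCardinality (GMatrices d N) g
    × (+ g) ℚ./ 1 ≡ sumFrom1To (2 ℕ.* d ∸ 1) (λ m →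
    (binom (+ (2 ℕ.* d)) (+ m) ℚ.- binom (+ d) (+ m ℤ.- + d))
    ℚ.* binom (+ N ℤ.- 1ℤ) (+ m ℤ.- 1ℤ)))
-- As p = d = d′ + 1, the closed form is `#Marked-C` at a = d and q = d′.
mainTheorem4 (suc d′) _ N = #Marked d d N , GMatrices-finite d′ N
                          , closedForm⇒formula d′ N (#Marked d d N) (#Marked-C d d′ N)
  where d = suc d′
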